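{- Let $G$ be a countable group, and identify $\mathbf{P}_G$ with $\{0,1\}^G$ with the product topology. Then the family of all sparse subsets of $G$ is a coanalytic subset of $\mathbf{P}_G$, and the family of all $P$-small subsets of $G$ is an analytic subset of $\mathbf{P}_G$.
   Context: $\mathbf{P}_G$ is the power set of $G$, identified with $\{0,1\}^G$ via characteristic functions (a Polish space when $G$ is countable). A subset $A\subseteq G$ is sparse if for every infinite subset $X\subseteq G$ there is a finite subset $F\subseteq X$ such that $\bigcap_{g\in F}gA$ is finite. $A$ is $P$-small if there is an injective sequence $(g_n)_{n\in\omega}$ in $G$ such that the sets $g_nA$, $n\in\omega$, are pairwise disjoint. A subset of a Polish space is analytic if it is a continuous image of a Polish space, and coanalytic if its complement is analytic. -}

module Defs where

open import Algebra.Bundles using (Group)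
open import Data.Bool.Base using (Bool; true)
open import Data.Empty using (⊥-elim)
open import Data.List.Base using (List; []; _∷_; _++_)
open import Data.List.Membership.Setoid as ListMembership using ()
open import Data.List.Relation.Unary.All as All using (All)
open import Data.List.Relation.Unary.All.Properties using (++⁻ˡ; ++⁻ʳ)
open import Data.Nat.Base as ℕ using (ℕ)
open import Data.Product.Base using (Σ; Σ-syntax; ∃; ∃-syntax; _×_; _,_; proj₁; proj₂)
open import Data.Rational.Base using (ℚ; 0ℚ; 1ℚ; _<_) renaming (_+_ to _+ℚ_; -_ to -ℚ_)
import Data.Rational.Properties as ℚₚ
open import Function.Bundles using (Func; Injection; _⇔_; _⟨$⟩_)
open import Function.Definitions using (Injective)
import Function.Relation.Binary.Setoid.Equality as FuncEquality
open import Function.Metric.Structures using (IsGeneralMetric)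
open import Level using (Level; 0ℓ; suc; _⊔_)
open import Relation.Binary.Bundles using (Setoid)
import Relation.Binary.Construct.On as On
open import Relation.Binary.Definitions using (tri<; tri≈; tri>)
open import Relation.Binary.PropositionalEquality as ≡ using (_≡_; _≢_; refl)
open import Relation.Binary.Structures using (IsPartialOrder)
open import Relation.Nullary using (¬_)
open import Relation.Unary using (Pred; _∈_; _∉_; _⊆_; _≐_; _∩_; _⊥_; _⊢_; ⋃; ⋂; ∁; Satisfiable)
open import Relation.Unary.Polymorphic using (U)

private
  variable
    a b c ℓ m p q : Level

------------------------------------------------------------------------
-- Real numbers

-- A Dedekind cut, given by its upper half { q ∈ ℚ ∣ x < q }.  All of this
-- is meant to be used under excluded middle, where the lower half carries
-- no further information.

record ℝ : Set₁ where
  field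
    upper     : Pred ℚ 0ℓ
    inhabited : ∃[ q ] q ∈ upper
    bounded   : ∃[ q ] q ∉ upper
    up-closed : ∀ {q r} → q ∈ upper → q < r → r ∈ upper
    rounded   : ∀ {q} → q ∈ upper → ∃[ r ] r < q × r ∈ upper

open ℝ public using (upper)

infix 4 _<ʳ_ _≤ʳ_ _≈ʳ_
infixl 6 _+ʳ_

-- Comparison of a real with a rational.

_<ʳ_ : ℝ → ℚ → Set
x <ʳ q = q ∈ upper x

_≤ʳ_ : ℝ → ℝ → Set
x ≤ʳ y = upper y ⊆ upper x

_≈ʳ_ : ℝ → ℝ → Set
x ≈ʳ y = upper x ≐ upper y

0ʳ : ℝ
0ʳ = record
  { upper     = 0ℚ <_
  ; inhabited = 1ℚ , ℚₚ.positive⁻¹ 1ℚ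
  ; bounded   = 0ℚ , ℚₚ.<-irrefl refl
  ; up-closed = ℚₚ.<-trans
  ; rounded   = λ 0<q → let (r , 0<r , r<q) = ℚₚ.<-dense 0<q in r , r<q , 0<r
  }

_+ʳ_ : ℝ → ℝ → ℝ
x +ʳ y = record
  { upper     = λ s → ∃[ q ] ∃[ r ] q ∈ X.upper × r ∈ Y.upper × s ≡ q +ℚ r
  ; inhabited = let (q , q∈) = X.inhabited ; (r , r∈) = Y.inhabited
                in q +ℚ r , q , r , q∈ , r∈ , refl
  ; bounded   = let (b , b∉) = X.bounded ; (c , c∉) = Y.bounded
                in b +ℚ c , λ (q , r , q∈ , r∈ , eq) →
                     ℚₚ.<-irrefl eq (ℚₚ.+-mono-< (above x b∉ q∈) (above y c∉ r∈))
  ; up-closed = λ { {_} {t} (q , r , q∈ , r∈ , refl) s<t →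
                    q , (-ℚ q) +ℚ t , q∈
                      , Y.up-closed r∈ (≡.subst (_< ((-ℚ q) +ℚ t)) (cancelˡ q r)
                                                (ℚₚ.+-monoʳ-< (-ℚ q) s<t))
                      , ≡.sym (cancelʳ q t) }
  ; rounded   = λ { (q , r , q∈ , r∈ , refl) →
                    let (q′ , q′<q , q′∈) = X.rounded q∈
                    in q′ +ℚ r , ℚₚ.+-monoˡ-< r q′<q , q′ , r , q′∈ , r∈ , refl }
  }
  where
  module X = ℝ x
  module Y = ℝ y

  above : (z : ℝ) → ∀ {b q} → b ∉ upper z → q ∈ upper z → b < q
  above z {b} {q} b∉ q∈ with ℚₚ.<-cmp b q
  ... | tri< b<q _ _  = b<q
  ... | tri≈ _ refl _ = ⊥-elim (b∉ q∈)
  ... | tri> _ _ q<b  = ⊥-elim (b∉ (ℝ.up-closed z q∈ q<b))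

  cancelˡ : ∀ q r → (-ℚ q) +ℚ (q +ℚ r) ≡ r
  cancelˡ q r = ≡.trans (≡.sym (ℚₚ.+-assoc (-ℚ q) q r))
                (≡.trans (≡.cong (_+ℚ r) (ℚₚ.+-inverseˡ q)) (ℚₚ.+-identityˡ r))

  cancelʳ : ∀ q t → q +ℚ ((-ℚ q) +ℚ t) ≡ t
  cancelʳ q t = ≡.trans (≡.sym (ℚₚ.+-assoc q (-ℚ q) t))
                (≡.trans (≡.cong (_+ℚ t) (ℚₚ.+-inverseʳ q)) (ℚₚ.+-identityˡ t))

≤ʳ-isPartialOrder : IsPartialOrder _≈ʳ_ _≤ʳ_
≤ʳ-isPartialOrder = record
  { isPreorder = record
    { isEquivalence = record
      { refl  = (λ q → q) , (λ q → q)
      ; sym   = λ (f , g) → g , f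
      ; trans = λ (f , g) (h , k) → (λ q → h (f q)) , (λ q → g (k q))
      }
    ; reflexive = λ (_ , g) → g
    ; trans     = λ f g q → f (g q)
    }
  ; antisym = λ f g → g , f
  }

------------------------------------------------------------------------
-- Countable and finite sets

-- "Countable" means finite or countably infinite.

Countable : Setoid a ℓ → Set (a ⊔ ℓ)
Countable S = Injection S (≡.setoid ℕ)

module _ (S : Setoid a ℓ) where
  open Setoid S using (Carrier)
  open ListMembership S using () renaming (_∈_ to _∈ˡ_)

  Finite : Pred Carrier p → Set (a ⊔ ℓ ⊔ p)
  Finite P = ∃[ xs ] P ⊆ (_∈ˡ xs)

  Infinite : Pred Carrier p → Set (a ⊔ ℓ ⊔ p)
  Infinite P = ¬ Finite P

  CountableSubset : Pred Carrier p → Set (a ⊔ ℓ ⊔ p)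
  CountableSubset P = Countable (On.setoid S (proj₁ {B = P}))

------------------------------------------------------------------------
-- Topological and Polish spaces

-- The points form a setoid, and open sets are closed under its equality.
-- The level p is that of the predicates standing for sets of points.

record TopologicalSpace a ℓ p : Set (suc (a ⊔ ℓ ⊔ p)) where
  field
    setoid : Setoid a ℓ

  open Setoid setoid public using (Carrier; _≈_)

  field
    IsOpen   : Pred (Pred Carrier p) p
    respects : ∀ {V} → IsOpen V → ∀ {x y} → x ≈ y → x ∈ V → y ∈ V
    ≐-closed : ∀ {V W} → V ≐ W → IsOpen V → IsOpen W
    U-open   : IsOpen U
    ∩-open   : ∀ {V W} → IsOpen V → IsOpen W → IsOpen (V ∩ W)
    ⋃-open   : (I : Set p) (V : I → Pred Carrier p) →
               (∀ i → IsOpen (V i)) → IsOpen (⋃ I V)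

module _ (X : TopologicalSpace a ℓ p) where
  open TopologicalSpace X

  Dense : Pred Carrier q → Set (a ⊔ suc p ⊔ q)
  Dense D = ∀ V → IsOpen V → Satisfiable V → Satisfiable (V ∩ D)

  Separable : Set (a ⊔ ℓ ⊔ suc p)
  Separable = Σ[ D ∈ Pred Carrier p ] CountableSubset setoid D × Dense D

  IsMetric : (Carrier → Carrier → ℝ) → Set (suc 0ℓ ⊔ a ⊔ ℓ)
  IsMetric d = IsGeneralMetric _≈_ _≈ʳ_ _≤ʳ_ 0ʳ _+ʳ_ d

  module _ (d : Carrier → Carrier → ℝ) where

    -- Rational radii suffice, as ℚ is dense in ℝ.

    MetricOpen : Pred (Pred Carrier p) (a ⊔ p)
    MetricOpen V = ∀ x → x ∈ V →
      ∃[ ε ] 0ℚ < ε × (∀ y → d x y <ʳ ε → y ∈ V)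

    Induces : Set (a ⊔ suc p)
    Induces = ∀ V → IsOpen V ⇔ MetricOpen V

    Cauchy : Pred (ℕ → Carrier) 0ℓ
    Cauchy s = ∀ ε → 0ℚ < ε →
      ∃[ N ] ∀ m n → N ℕ.≤ m → N ℕ.≤ n → d (s m) (s n) <ʳ ε

    ConvergesTo : (ℕ → Carrier) → Carrier → Set
    ConvergesTo s x = ∀ ε → 0ℚ < ε → ∃[ N ] ∀ n → N ℕ.≤ n → d (s n) x <ʳ ε

    Complete : Set a
    Complete = ∀ s → Cauchy s → ∃[ x ] ConvergesTo s x

  CompletelyMetrizable : Set (suc 0ℓ ⊔ a ⊔ ℓ ⊔ suc p)
  CompletelyMetrizable = ∃[ d ] IsMetric d × Induces d × Complete d

  IsPolish : Set (suc 0ℓ ⊔ a ⊔ ℓ ⊔ suc p)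
  IsPolish = Separable × CompletelyMetrizable

------------------------------------------------------------------------
-- Analytic sets

module _ (Y : TopologicalSpace b m p) (X : TopologicalSpace a ℓ p) where
  private
    module Y = TopologicalSpace Y
    module X = TopologicalSpace X

  Continuous : Pred (Func Y.setoid X.setoid) (a ⊔ suc p)
  Continuous f = ∀ V → X.IsOpen V → Y.IsOpen ((f ⟨$⟩_) ⊢ V)

  Image : Func Y.setoid X.setoid → Pred X.Carrier (b ⊔ ℓ)
  Image f x = ∃[ y ] f ⟨$⟩ y X.≈ x

-- The empty space is Polish, so the empty set is analytic.

module _ (X : TopologicalSpace a ℓ p) where
  open TopologicalSpace X

  Analytic : Pred (Pred Carrier q) (a ⊔ ℓ ⊔ suc p ⊔ q)
  Analytic S = Σ[ Y ∈ TopologicalSpace p p p ] IsPolish Y ×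
    (Σ[ f ∈ Func (TopologicalSpace.setoid Y) setoid ]
      Continuous Y X f × S ≐ Image Y X f)

  Coanalytic : Pred (Pred Carrier q) (a ⊔ ℓ ⊔ suc p ⊔ q)
  Coanalytic S = Analytic (∁ S)

------------------------------------------------------------------------
-- Subsets of a group

module _ (G : Group c ℓ) where
  open Group G using (Carrier; _≈_; _∙_) renaming (setoid to setoidᴳ)

  Subset : Set (c ⊔ ℓ)
  Subset = Func setoidᴳ (≡.setoid Bool)

  ⟦_⟧ : Subset → Pred Carrier 0ℓ
  ⟦ A ⟧ x = A ⟨$⟩ x ≡ true

  -- V is open iff with every A it contains a basic set
  -- { B ∣ B(g) = A(g) for all g in F }, F finite.

  𝐏 : TopologicalSpace (c ⊔ ℓ) c (c ⊔ ℓ)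
  𝐏 = record
    { setoid   = FuncEquality.setoid setoidᴳ (≡.setoid Bool)
    ; IsOpen   = λ V → ∀ A → A ∈ V → ∃[ F ] ∀ B → Agree A B F → B ∈ V
    ; respects = λ o A≈B A∈V → proj₂ (o _ A∈V) _ (All.universal (λ g → ≡.sym (A≈B g)) _)
    ; ≐-closed = λ (V⊆W , W⊆V) o A A∈W →
        let (F , h) = o A (W⊆V A∈W) in F , λ B e → V⊆W (h B e)
    ; U-open   = λ _ _ → [] , _
    ; ∩-open   = λ o₁ o₂ A (A∈V , A∈W) →
        let (F₁ , h₁) = o₁ A A∈V ; (F₂ , h₂) = o₂ A A∈W
        in F₁ ++ F₂ , λ B e → h₁ B (++⁻ˡ F₁ e) , h₂ B (++⁻ʳ F₁ e)
    ; ⋃-open   = λ I V o A (i , A∈V) →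
        let (F , h) = o i A A∈V in F , λ B e → i , h B e
    }
    where
    Agree : Subset → Subset → List Carrier → Set c
    Agree A B = All (λ g → B ⟨$⟩ g ≡ A ⟨$⟩ g)

  translate : Carrier → Subset → Pred Carrier (c ⊔ ℓ)
  translate g A x = ∃[ y ] y ∈ ⟦ A ⟧ × x ≈ g ∙ y

  Sparse : Pred Subset (c ⊔ ℓ)
  Sparse A = (X : Subset) → Infinite setoidᴳ ⟦ X ⟧ →
    Σ[ F ∈ Subset ] Finite setoidᴳ ⟦ F ⟧ × ⟦ F ⟧ ⊆ ⟦ X ⟧ ×
      Finite setoidᴳ (⋂ (∃[ g ] g ∈ ⟦ F ⟧) (λ (g , _) → translate g A))

  PSmall : Pred Subset (c ⊔ ℓ)
  PSmall A = Σ[ g ∈ (ℕ → Carrier) ] Injective _≡_ _≈_ g ×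
    (∀ m n → m ≢ n → translate (g m) A ⊥ translate (g n) A)

{-# OPTIONS --safe #-}
module Submission where

-- Projections { A ∣ ∃ w, R A w } of closed relations R between subsets A of G
-- and sequences w in a countable set are analytic: R is itself a Polish space,
-- being closed in a countable product of countable discrete spaces.
-- The definition of P-smallness already has this form, with w the sequence g.
-- A set A is not sparse iff there are injective sequences x and z in G with
-- z n ∈ x k A for all k < n, which is a closed condition on A and (x , z).
-- Given an infinite X violating sparseness, let x enumerate distinct elements
-- of X and choose the z n one after another in the infinite intersections of
-- the x k A, k < n.  Conversely, every finite F ⊆ { x k } lies in some initial
-- segment { x k ∣ k < N }, so the intersection of the g A, g ∈ F, contains all
-- z n with n ≥ N.

open import Defs
open import Algebra.Bundles using (Group)
import Algebra.Properties.Group as GroupProperties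
open import Axiom.ExcludedMiddle using (ExcludedMiddle)
open import Data.Bool.Base using (Bool; true; false)
open import Data.Empty using (⊥-elim)
open import Data.Fin.Base using (toℕ)
open import Data.Fin.Properties using (pigeonhole)
open import Data.Integer.Base using (+_; -[1+_]; +<+)
open import Data.List.Base using (List; []; _∷_; length; applyUpTo)
import Data.List.Membership.Setoid as ListMembership
open import Data.List.Membership.Setoid.Properties using (index-injective)
open import Data.List.Relation.Unary.All as All using (All; []; _∷_)
open import Data.List.Relation.Unary.Any using (here; there; index)
import Data.List.Relation.Unary.Any.Properties as Any
open import Data.Nat.Base using (ℕ; zero; suc; _+_; _*_; _≤_; _<_; _⊔_; z≤n; s≤s; z<s; s≤s⁻¹)
open import Data.Nat.Coprimality using (1-coprimeTo)
import Data.Nat.Properties as ℕₚ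
open import Data.Product.Base using (Σ-syntax; ∃; ∃-syntax; _×_; _,_; proj₁; proj₂)
open import Data.Product.Relation.Binary.Pointwise.NonDependent using (_×ₛ_)
open import Data.Rational.Base as ℚ using (ℚ; mkℚ; 0ℚ; *<*) renaming (_<_ to _<ℚ_)
import Data.Rational.Properties as ℚₚ
open import Data.Sum.Base using (inj₁; inj₂)
open import Function.Base using (_∘_; case_of_)
open import Function.Bundles using (Func; Injection; mk⇔; _⟨$⟩_)
open import Function.Definitions using (Injective)
open import Level using (Level; Lift; lift; lower) renaming (_⊔_ to _⊔ˡ_)
open import Relation.Binary.Bundles using (Setoid)
open import Relation.Binary.Definitions using (tri<; tri≈; tri>)
open import Relation.Binary.PropositionalEquality using (_≡_; _≢_; refl; sym; trans; cong; cong₂; subst)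
open import Relation.Nullary using (¬_; Dec; yes; no; does; contradiction)
open import Relation.Nullary.Decidable using (does-⇔; decidable-stable; dec-true; dec-false)
open import Relation.Unary using (Pred; _∈_; _⊆_; _≐_; _⊥_; ⋂)

private
  variable
    a b c p q ℓ ℓ′ : Level

-- The radii 1/(n+1).

radius : ℕ → ℚ
radius n = mkℚ (+ 1) n (1-coprimeTo (suc n))

radius-positive : ∀ n → 0ℚ <ℚ radius n
radius-positive n = *<* (+<+ z<s)

radius-cancel-< : ∀ {m n} → radius m <ℚ radius n → n < m
radius-cancel-< {m} {n} (*<* (+<+ lt)) rewrite ℕₚ.+-identityʳ n | ℕₚ.+-identityʳ m = s≤s⁻¹ lt

radius-archimedean : ∀ {ε} → 0ℚ <ℚ ε → ∃[ n ] radius n <ℚ ε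
radius-archimedean {mkℚ (+ zero) _ _}  (*<* (+<+ ()))
-- Here ε is (n+1)/(d+1); the index `suc d` gives 1/(d+2), strictly below ε even for numerator 1.
radius-archimedean {mkℚ (+ suc n) d _} _ = suc d , *<* (+<+ (begin-strict
  1 * suc d               ≡⟨ ℕₚ.*-identityˡ (suc d) ⟩
  suc d                   <⟨ ℕₚ.n<1+n (suc d) ⟩
  suc (suc d)             ≤⟨ ℕₚ.m≤n*m (suc (suc d)) (suc n) ⟩
  suc n * suc (suc d)     ∎))
  where open ℕₚ.≤-Reasoning
radius-archimedean {mkℚ -[1+ _ ] _ _}  (*<* ())

p<p+q : ∀ p {q} → 0ℚ <ℚ q → p <ℚ p ℚ.+ q
p<p+q p {q} 0<q = subst (_<ℚ p ℚ.+ q) (ℚₚ.+-identityʳ p) (ℚₚ.+-monoʳ-< p 0<q)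

q<p+q : ∀ q {p} → 0ℚ <ℚ p → q <ℚ p ℚ.+ q
q<p+q q {p} 0<p = subst (_<ℚ p ℚ.+ q) (ℚₚ.+-identityˡ q) (ℚₚ.+-monoˡ-< q 0<p)

-- Countability, least numbers and injective sequences.

-- This is 2^m (2n+1); parity recovers `m`, then `n`.
pair : ℕ → ℕ → ℕ
pair zero    n = suc (2 * n)
pair (suc m) n = 2 * pair m n

pair-injective : ∀ m n {m′ n′} → pair m n ≡ pair m′ n′ → m ≡ m′ × n ≡ n′
pair-injective zero    n {zero}   {n′} eq = refl , ℕₚ.*-cancelˡ-≡ n n′ 2 (ℕₚ.suc-injective eq)
pair-injective zero    n {suc m′} {n′} eq = contradiction (sym eq) (ℕₚ.even≢odd (pair m′ n′) n)
pair-injective (suc m) n {zero}   {n′} eq = contradiction eq (ℕₚ.even≢odd (pair m n) n′)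
pair-injective (suc m) n {suc m′} {n′} eq
  with pair-injective m n {m′} {n′} (ℕₚ.*-cancelˡ-≡ (pair m n) (pair m′ n′) 2 eq)
... | refl , refl = refl , refl

×-countable : {S : Setoid a ℓ} {T : Setoid b ℓ′} → Countable S → Countable T → Countable (S ×ₛ T)
×-countable ι κ = record
  { to        = λ (x , y) → pair (ι.to x) (κ.to y)
  ; cong      = λ (x≈ , y≈) → cong₂ pair (ι.cong x≈) (κ.cong y≈)
  ; injective = λ eq → let (eqˣ , eqʸ) = pair-injective _ _ eq in ι.injective eqˣ , κ.injective eqʸ
  }
  where
  module ι = Injection ι
  module κ = Injection κ

bit : Bool → ℕ
bit false = 0
bit true  = 1

bit-injective : ∀ {x y} → bit x ≡ bit y → x ≡ y
bit-injective {false} {false} _ = refl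
bit-injective {true}  {true}  _ = refl

Least : Pred ℕ p → Pred ℕ p
Least P n = P n × (∀ m → P m → n ≤ m)

Least-unique : {P : Pred ℕ p} {Q : Pred ℕ q} → P ≐ Q → ∀ {m n} → Least P m → Least Q n → m ≡ n
Least-unique (P⊆Q , Q⊆P) (Pm , m≤) (Qn , n≤) = ℕₚ.≤-antisym (m≤ _ (Q⊆P Qn)) (n≤ _ (P⊆Q Pm))

module _ (S : Setoid a ℓ) where
  open Setoid S using (Carrier; _≈_; _≉_) renaming (sym to ≈-sym)

  apart⇒injective : {s : ℕ → Carrier} → (∀ {m n} → m < n → s m ≉ s n) → Injective _≡_ _≈_ s
  apart⇒injective apart {m} {n} eq with ℕₚ.<-cmp m n
  ... | tri< m<n _ _ = contradiction eq (apart m<n)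
  ... | tri≈ _ m≡n _ = m≡n
  ... | tri> _ _ n<m = contradiction (≈-sym eq) (apart n<m)

  -- Pigeonhole: among the first `length xs + 1` terms, two would occupy the same position of a
  -- covering list `xs`.
  injective⇒infinite : {s : ℕ → Carrier} {P : Pred Carrier p} →
                       Injective _≡_ _≈_ s → (∀ n → s n ∈ P) → Infinite S P
  injective⇒infinite inj s∈P (xs , P⊆xs) =
    let (i , j , i<j , eq) = pigeonhole (ℕₚ.n<1+n (length xs)) (λ i → index (P⊆xs (s∈P (toℕ i))))
    in ℕₚ.<⇒≢ i<j (inj (index-injective S (P⊆xs (s∈P _)) (P⊆xs (s∈P _)) eq))

-- The complete metric of a labelled space.

-- Points x and y are at distance at most 1/(n+1) when they share the label
-- κ n; completeness makes every coherent sequence of labels come from a point.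

record Labelling (Y : Set p) : Set p where
  field
    κ        : ℕ → Y → ℕ
    κ-zero   : ∀ x y → κ 0 x ≡ κ 0 y
    refines  : ∀ k {x y} → κ (suc k) x ≡ κ (suc k) y → κ k x ≡ κ k y
    complete : (s : ℕ → Y) → (∀ {k m} → k ≤ m → κ k (s k) ≡ κ k (s m)) →
               ∃[ x ] ∀ k → κ k (s k) ≡ κ k x

module LabelledSpace {p} {Y : Set p} (L : Labelling Y) where
  open Labelling L

  κ-mono : ∀ {m n x y} → m ≤ n → κ n x ≡ κ n y → κ m x ≡ κ m y
  κ-mono {n = zero}  z≤n eq = eq
  κ-mono {n = suc n} m≤n eq with ℕₚ.m≤n⇒m<n∨m≡n m≤n
  ... | inj₁ m<n  = κ-mono (s≤s⁻¹ m<n) (refines n eq)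
  ... | inj₂ refl = eq

  infix 4 _≈ʸ_
  _≈ʸ_ : Y → Y → Set p
  x ≈ʸ y = Lift p (∀ k → κ k x ≡ κ k y)

  space : TopologicalSpace p p p
  space = record
    { setoid   = record
      { Carrier = Y
      ; _≈_     = _≈ʸ_
      ; isEquivalence = record
        { refl  = lift λ _ → refl
        ; sym   = λ (lift e) → lift λ k → sym (e k)
        ; trans = λ (lift e) (lift f) → lift λ k → trans (e k) (f k)
        }
      }
    ; IsOpen   = λ V → ∀ x → x ∈ V → ∃[ k ] ∀ y → κ k x ≡ κ k y → y ∈ V
    ; respects = λ {V} o {x} {y} x≈y x∈V → proj₂ (o x x∈V) y (lower x≈y (proj₁ (o x x∈V)))
    ; ≐-closed = λ {V} (V⊆W , W⊆V) o x x∈W → let (k , h) = o x (W⊆V x∈W) in k , λ y e → V⊆W {y} (h y e)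
    ; U-open   = λ _ _ → 0 , _
    ; ∩-open   = λ o₁ o₂ x (x∈V , x∈W) →
        let (k , h) = o₁ x x∈V ; (m , i) = o₂ x x∈W
        in k ⊔ m , λ y e → h y (κ-mono (ℕₚ.m≤m⊔n k m) e) , i y (κ-mono (ℕₚ.m≤n⊔m k m) e)
    ; ⋃-open   = λ I V o x (i , x∈V) → let (k , h) = o i x x∈V in k , λ y e → i , h y e
    }

  open TopologicalSpace space using (IsOpen)

  -- The infimum of 1/(n+1) over all `n` at which the labels agree; `κ-zero` makes `n = 0` always
  -- available.
  dist : Y → Y → ℝ
  dist x y = record
    { upper     = λ q → ∃[ n ] κ n x ≡ κ n y × radius n <ℚ q
    ; inhabited = let (q , 1<q) = above (radius 0) in q , 0 , κ-zero x y , 1<q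
    ; bounded   = 0ℚ , λ (n , _ , r<0) → ℚₚ.<-asym r<0 (radius-positive n)
    ; up-closed = λ (n , e , r<q) q<r → n , e , ℚₚ.<-trans r<q q<r
    ; rounded   = λ (n , e , r<q) → let (s , r<s , s<q) = ℚₚ.<-dense r<q in s , s<q , n , e , r<s
    }
    where
    above : ∀ q → ∃[ r ] q <ℚ r
    above q = q ℚ.+ radius 0 , p<p+q q (radius-positive 0)

  -- The witness has index `n > k`, and agreement of labels descends from `n` to `k`.
  dist<radius⇒κ≡ : ∀ {k} x y → dist x y <ʳ radius k → κ k x ≡ κ k y
  dist<radius⇒κ≡ x y (n , e , r<) = κ-mono (ℕₚ.<⇒≤ (radius-cancel-< r<)) e

  dist-isMetric : IsMetric space dist
  dist-isMetric = record
    { isSemiMetric = record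
      { isQuasiSemiMetric = record
        { isPreMetric = record
          { isProtoMetric = record
            { isPartialOrder  = ≤ʳ-isPartialOrder
            ; ≈-isEquivalence = Setoid.isEquivalence (TopologicalSpace.setoid space)
            ; cong            = λ (lift x≈) (lift y≈) →
                (λ (n , e , r<q) → n , trans (sym (x≈ n)) (trans e (y≈ n)) , r<q) ,
                (λ (n , e , r<q) → n , trans (x≈ n) (trans e (sym (y≈ n))) , r<q)
            ; nonNegative     = λ (n , _ , r<q) → ℚₚ.<-trans (radius-positive n) r<q
            }
          ; ≈⇒0 = λ (lift x≈y) →
              (λ (n , _ , r<q) → ℚₚ.<-trans (radius-positive n) r<q) ,
              (λ 0<q → let (n , r<q) = radius-archimedean 0<q in n , x≈y n , r<q)
          }
        ; 0⇒≈ = λ {x} {y} (_ , 0⊆) → lift λ k → dist<radius⇒κ≡ x y (0⊆ (radius-positive k))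
        }
      ; sym = λ _ _ → (λ (n , e , r<q) → n , sym e , r<q) , (λ (n , e , r<q) → n , sym e , r<q)
      }
    ; triangle = triangle
    }
    where
    -- Ultrametric argument: `x` and `z` share the label at the smaller of the two indices, whose
    -- radius is below one summand, and the other summand is positive.
    triangle : ∀ x y z → dist x z ≤ʳ dist x y +ʳ dist y z
    triangle x y z (q , r , (m , e , <q) , (n , f , <r) , refl) with ℕₚ.≤-total m n
    ... | inj₁ m≤n = m , trans e (κ-mono m≤n f) ,
                     ℚₚ.<-trans <q (p<p+q q (ℚₚ.<-trans (radius-positive n) <r))
    ... | inj₂ n≤m = n , trans (κ-mono n≤m e) f ,
                     ℚₚ.<-trans <r (q<p+q r (ℚₚ.<-trans (radius-positive m) <q))

  dist-induces : Induces space dist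
  dist-induces V = mk⇔ to from
    where
    to : IsOpen V → MetricOpen space dist V
    to o x x∈V = let (k , h) = o x x∈V in
      radius k , radius-positive k , λ y near → h y (dist<radius⇒κ≡ x y near)

    from : MetricOpen space dist V → IsOpen V
    from o x x∈V = let (ε , 0<ε , h) = o x x∈V ; (k , r<ε) = radius-archimedean 0<ε in
      k , λ y e → h y (k , e , r<ε)

  -- From index `N k` on, the label at level `k` is constant, so the subsequence `s ∘ N` is
  -- coherent.
  dist-complete : Complete space dist
  dist-complete s cauchy = x , λ ε 0<ε →
    let (k , r<ε) = radius-archimedean 0<ε in
    N k , λ n N≤n → k , trans (sym (settled k N≤n)) (lim k) , r<ε
    where
    N : ℕ → ℕ
    N k = proj₁ (cauchy (radius k) (radius-positive k))

    settled : ∀ k {n} → N k ≤ n → κ k (s (N k)) ≡ κ k (s n)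
    settled k N≤n = dist<radius⇒κ≡ _ _ (proj₂ (cauchy (radius k) (radius-positive k)) _ _ ℕₚ.≤-refl N≤n)

    coherent : ∀ {k m} → k ≤ m → κ k (s (N k)) ≡ κ k (s (N m))
    -- `N` need not be monotone, so both labels are compared with the one at `N k ⊔ N m`.
    coherent {k} {m} k≤m = trans (settled k (ℕₚ.m≤m⊔n (N k) (N m)))
      (sym (κ-mono k≤m (settled m (ℕₚ.m≤n⊔m (N k) (N m)))))

    limit = complete (s ∘ N) coherent
    x     = proj₁ limit
    lim   = proj₂ limit

-- Classical choices of numbers and sequences.

module Classical (em : ∀ {a} → ExcludedMiddle a) where

  least : (P : Pred ℕ p) → ∀ n → P n → ∃ (Least P)
  least P zero    P0 = 0 , P0 , λ _ _ → z≤n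
  least P (suc n) Pn with em {P = P 0}
  ... | yes P0 = 0 , P0 , λ _ _ → z≤n
  ... | no ¬P0 =
    let (m , Pm , m≤) = least (P ∘ suc) n Pn
    in suc m , Pm , λ { zero P0 → contradiction P0 ¬P0 ; (suc k) Pk → s≤s (m≤ k Pk) }

  module _ (S : Setoid a ℓ) where
    open Setoid S using (Carrier; _≈_; _≉_) renaming (sym to ≈-sym; trans to ≈-trans)
    open ListMembership S using () renaming (_∈_ to _∈ˡ_; _∉_ to _∉ˡ_)

    infinite⇒fresh : {P : Pred Carrier p} → Infinite S P → ∀ xs → ∃[ x ] x ∈ P × x ∉ˡ xs
    infinite⇒fresh {P = P} inf xs with em {P = ∃[ x ] x ∈ P × x ∉ˡ xs}
    ... | yes fresh = fresh
    ... | no ∄fresh = ⊥-elim (inf (xs , λ x∈P → decidable-stable em (λ x∉xs → ∄fresh (_ , x∈P , x∉xs))))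

    -- Each term is chosen outside the list of earlier ones. A constant family `P` extracts an
    -- injective sequence from one infinite set.
    distinct-representatives : (P : ℕ → Pred Carrier p) → (∀ n → Infinite S (P n)) →
      ∃[ z ] Injective _≡_ _≈_ z × (∀ n → z n ∈ P n)
    distinct-representatives P inf =
      z , apart⇒injective S z-apart , λ n → proj₁ (proj₂ (fresh n (earlier n)))
      where
      fresh : ∀ n xs → ∃[ x ] x ∈ P n × x ∉ˡ xs
      fresh n = infinite⇒fresh (inf n)

      earlier : ℕ → List Carrier
      earlier zero    = []
      earlier (suc n) = proj₁ (fresh n (earlier n)) ∷ earlier n

      z : ℕ → Carrier
      z n = proj₁ (fresh n (earlier n))

      z∈earlier : ∀ {m n x} → m < n → x ≈ z m → x ∈ˡ earlier n
      z∈earlier {n = suc n} m<1+n x≈ with ℕₚ.m≤n⇒m<n∨m≡n (s≤s⁻¹ m<1+n)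
      ... | inj₁ m<n  = there (z∈earlier m<n x≈)
      ... | inj₂ refl = here x≈

      z-apart : ∀ {m n} → m < n → z m ≉ z n
      z-apart {n = n} m<n eq = proj₂ (proj₂ (fresh n (earlier n))) (z∈earlier m<n (≈-sym eq))

  -- The dense set consists of one chosen point for each label in use.

  labelled-isPolish : {Y : Set p} (L : Labelling Y) → IsPolish (LabelledSpace.space L)
  labelled-isPolish {p = p} {Y = Y} L =
    (D , D-countable , D-dense) , dist , dist-isMetric , dist-induces , dist-complete
    where
    open Labelling L
    open LabelledSpace L

    -- The equation `em ≡ yes e` fixes `e` as the very witness returned by excluded middle, so `k`
    -- and `v` determine the point up to `≈ʸ`.
    Chosen : ℕ → ℕ → Pred Y p
    Chosen k v y = Σ[ e ∈ ∃[ x ] κ k x ≡ v ] em ≡ yes e × y ≈ʸ proj₁ e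

    Chosen-unique : ∀ {k v x y} → Chosen k v x → Chosen k v y → x ≈ʸ y
    Chosen-unique (e , eq , lift x≈) (f , eq′ , lift y≈) with trans (sym eq) eq′
    ... | refl = lift λ k → trans (x≈ k) (sym (y≈ k))

    Chosen-resp : ∀ {k v x y} → x ≈ʸ y → Chosen k v x → Chosen k v y
    Chosen-resp (lift x≈y) (e , eq , lift x≈) = e , eq , lift λ k → trans (sym (x≈y k)) (x≈ k)

    Code : Y → Pred ℕ p
    Code y n = ∃[ k ] ∃[ v ] n ≡ pair k v × Chosen k v y

    Code-unique : ∀ {n x y} → Code x n → Code y n → x ≈ʸ y
    Code-unique (k , v , refl , x∈) (k′ , v′ , eq , y∈) with pair-injective k v {k′} {v′} eq
    ... | refl , refl = Chosen-unique x∈ y∈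

    Code-resp : ∀ {x y} → x ≈ʸ y → Code x ⊆ Code y
    Code-resp x≈y (k , v , eq , x∈) = k , v , eq , Chosen-resp x≈y x∈

    D : Pred Y p
    D y = ∃ (Code y)

    -- A point can have several codes; the least one depends on the point alone, not on the proof
    -- that it lies in `D`.
    leastCode : ∀ {y} → y ∈ D → ∃ (Least (Code y))
    leastCode (n , yₙ) = least _ n yₙ

    D-countable : CountableSubset (TopologicalSpace.setoid space) D
    D-countable = record
      { to        = λ (y , y∈D) → proj₁ (leastCode y∈D)
      ; cong      = λ { {x , x∈D} {y , y∈D} x≈y → Least-unique
          (Code-resp x≈y , Code-resp (lift λ k → sym (lower x≈y k)))
          (proj₂ (leastCode x∈D)) (proj₂ (leastCode y∈D)) }
      ; injective = λ { {x , x∈D} {y , y∈D} eq →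
          Code-unique (proj₁ (proj₂ (leastCode x∈D)))
            (subst (Code y) (sym eq) (proj₁ (proj₂ (leastCode y∈D)))) }
      }

    D-dense : Dense space D
    D-dense V V-open (x , x∈V) with V-open x x∈V
    -- The recorded equation `eq` is what `Chosen` asks for; `x` itself rules out the negative case.
    ... | k , h with em {P = ∃[ y ] κ k y ≡ κ k x} in eq
    ...   | yes e = proj₁ e , h _ (sym (proj₂ e)) ,
                    pair k (κ k x) , k , κ k x , refl , e , eq , lift (λ _ → refl)
    ...   | no ∄  = contradiction (x , refl) ∄

  -- Subsets of G as binary sequences.

  module _ (G : Group c ℓ) (countable : Countable (Group.setoid G)) where
    open Group G using (Carrier; _≈_; _∙_; _⁻¹; ∙-cong; ∙-congˡ; ∙-congʳ; ⁻¹-cong)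
      renaming (setoid to setoidᴳ; refl to ≈-refl; sym to ≈-sym; trans to ≈-trans)
    open GroupProperties G using (\\-leftDividesˡ; \\-leftDividesʳ)
    open ListMembership setoidᴳ using () renaming (_∈_ to _∈ˡ_)
    open Injection countable using () renaming (to to ι; cong to ι-cong; injective to ι-injective)

    comprehension : (P : Pred Carrier p) → (∀ {x y} → x ≈ y → P x → P y) → Subset G
    comprehension P resp = record
      { to   = λ x → does (em {P = P x})
      ; cong = λ x≈y → does-⇔ (mk⇔ (resp x≈y) (resp (≈-sym x≈y))) em em
      }

    does⇒ : {P : Set p} (P? : Dec P) → does P? ≡ true → P
    does⇒ (yes p) _ = p

    module _ (P : Pred Carrier p) (resp : ∀ {x y} → x ≈ y → P x → P y) where

      ∈-comprehension⁺ : P ⊆ ⟦ G ⟧ (comprehension P resp)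
      ∈-comprehension⁺ = dec-true em

      ∈-comprehension⁻ : ⟦ G ⟧ (comprehension P resp) ⊆ P
      ∈-comprehension⁻ = does⇒ em

    -- Reads `A` along the indexing `ι`, with default `false` at numbers that index no element, as
    -- happens for finite G.
    digit : Subset G → ℕ → Bool
    digit A n = does (em {P = ∃[ h ] ι h ≡ n × h ∈ ⟦ G ⟧ A})

    digit-cong : ∀ A B {n} → (∀ h → ι h ≡ n → A ⟨$⟩ h ≡ B ⟨$⟩ h) → digit A n ≡ digit B n
    digit-cong A B A≡B = does-⇔ (mk⇔
      (λ (h , eq , h∈A) → h , eq , trans (sym (A≡B h eq)) h∈A)
      (λ (h , eq , h∈B) → h , eq , trans (A≡B h eq) h∈B)) em em

    digit-ι : ∀ A h → digit A (ι h) ≡ A ⟨$⟩ h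
    digit-ι A h with A ⟨$⟩ h in eq
    ... | true  = dec-true em (h , refl , eq)
    ... | false = dec-false em λ (g , ιg≡ιh , g∈A) →
      case trans (sym g∈A) (trans (Func.cong A (ι-injective ιg≡ιh)) eq) of λ ()

    -- Projections of closed relations.

    module _ (T : Setoid c ℓ) where
      private module T = Setoid T

      AgreeBelow : ℕ → (A B : Subset G) (v w : ℕ → T.Carrier) → Set (c ⊔ˡ ℓ)
      AgreeBelow k A B v w = (∀ h → ι h < k → A ⟨$⟩ h ≡ B ⟨$⟩ h) × (∀ n → n < k → v n T.≈ w n)

      -- Closedness in the product topology with `T` discrete: a pair belongs to `R` once each of
      -- its basic neighbourhoods meets `R`.
      Closed : (Subset G → Pred (ℕ → T.Carrier) (c ⊔ˡ ℓ)) → Set (c ⊔ˡ ℓ)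
      Closed R = ∀ A w → (∀ k → ∃[ B ] ∃[ v ] R B v × AgreeBelow k A B w v) → R A w

    module _ {T : Setoid c ℓ} (T-countable : Countable T)
             {R : Subset G → Pred (ℕ → Setoid.Carrier T) (c ⊔ˡ ℓ)} (R-closed : Closed T R) where
      private module T = Setoid T
      open Injection T-countable using () renaming (to to τ; cong to τ-cong; injective to τ-injective)

      Graph : Set (c ⊔ˡ ℓ)
      Graph = Σ[ (A , w) ∈ Subset G × (ℕ → T.Carrier) ] R A w

      -- The label at level `k` packs the first `k` digits of `A` and the first `k` terms of `w`;
      -- equal labels amount to `AgreeBelow` at `k`.
      code : ℕ → Graph → ℕ
      code zero    _               = 0
      code (suc k) x@((A , w) , _) = pair (code k x) (pair (bit (digit A k)) (τ (w k)))

      code⇒digit,τ : ∀ k (x@((A , v) , _) y@((B , w) , _) : Graph) → code k x ≡ code k y →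
                     ∀ n → n < k → digit A n ≡ digit B n × v n T.≈ w n
      code⇒digit,τ (suc k) x@((A , v) , _) y@((B , w) , _) eq n n<1+k
        with pair-injective (code k x) (pair (bit (digit A k)) (τ (v k)))
                            {code k y} {pair (bit (digit B k)) (τ (w k))} eq
      ... | eqᵏ , eq′ with pair-injective (bit (digit A k)) (τ (v k)) {bit (digit B k)} {τ (w k)} eq′
      ...   | eqᵇ , eqᵗ with ℕₚ.m≤n⇒m<n∨m≡n (s≤s⁻¹ n<1+k)
      ...     | inj₁ n<k  = code⇒digit,τ k x y eqᵏ n n<k
      ...     | inj₂ refl = bit-injective eqᵇ , τ-injective eqᵗ

      code⇒agree : ∀ k (x@((A , v) , _) y@((B , w) , _) : Graph) → code k x ≡ code k y →
                   AgreeBelow T k A B v w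
      code⇒agree k x@((A , _) , _) y@((B , _) , _) eq =
        (λ h ιh<k → trans (sym (digit-ι A h))
                     (trans (proj₁ (code⇒digit,τ k x y eq (ι h) ιh<k)) (digit-ι B h))) ,
        (λ n n<k → proj₂ (code⇒digit,τ k x y eq n n<k))

      agree⇒code : ∀ k (x@((A , v) , _) y@((B , w) , _) : Graph) → AgreeBelow T k A B v w →
                   code k x ≡ code k y
      agree⇒code zero    _ _ _ = refl
      agree⇒code (suc k) x@((A , _) , _) y@((B , _) , _) (A≡B , v≈w) = cong₂ pair
        (agree⇒code k x y ((λ h lt → A≡B h (ℕₚ.m<n⇒m<1+n lt)) , (λ n lt → v≈w n (ℕₚ.m<n⇒m<1+n lt))))
        (cong₂ pair (cong bit (digit-cong A B λ h eq → A≡B h (s≤s (ℕₚ.≤-reflexive eq))))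
                    (τ-cong (v≈w k (ℕₚ.n<1+n k))))

      labelling : Labelling Graph
      labelling = record
        { κ        = code
        ; κ-zero   = λ _ _ → refl
        ; refines  = λ k {x} {y} eq → proj₁ (pair-injective (code k x) _ eq)
        ; complete = λ s coherent →
            let module Limit = LimitOf s coherent
            in Limit.x , λ k → sym (agree⇒code k Limit.x (s k) (Limit.agree k))
        }
        where
        module LimitOf (s : ℕ → Graph) (coherent : ∀ {k m} → k ≤ m → code k (s k) ≡ code k (s m)) where

          Aᵢ : ℕ → Subset G
          Aᵢ = proj₁ ∘ proj₁ ∘ s

          wᵢ : ℕ → ℕ → T.Carrier
          wᵢ = proj₂ ∘ proj₁ ∘ s

          A : Subset G
          A = record
            -- Level `suc (ι h)` is the first whose label fixes the value at `h`; by coherence later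
            -- levels keep it.
            { to   = λ h → Aᵢ (suc (ι h)) ⟨$⟩ h
            ; cong = λ {g} {h} g≈h → trans (Func.cong (Aᵢ (suc (ι g))) g≈h)
                       (cong (λ n → Aᵢ (suc n) ⟨$⟩ h) (ι-cong g≈h))
            }

          w : ℕ → T.Carrier
          w n = wᵢ (suc n) n

          agree : ∀ k → AgreeBelow T k A (Aᵢ k) w (wᵢ k)
          agree k =
            (λ h lt → proj₁ (code⇒agree (suc (ι h)) (s _) (s k) (coherent lt)) h (ℕₚ.n<1+n _)) ,
            (λ n lt → proj₂ (code⇒agree (suc n) (s _) (s k) (coherent lt)) n (ℕₚ.n<1+n _))

          x : Graph
          -- The stages are members of `R` approximating the limit, so closedness puts the limit
          -- into the graph.
          x = (A , w) , R-closed A w λ k → Aᵢ k , wᵢ k , proj₂ (s k) , agree k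

      open LabelledSpace labelling using (space)

      index-bound : (F : List Carrier) → ∃[ k ] All (λ g → ι g < k) F
      index-bound []      = 0 , []
      index-bound (g ∷ F) = let (k , bounded) = index-bound F in
        suc (ι g) ⊔ k , ℕₚ.m≤m⊔n (suc (ι g)) k ∷
        All.map (λ lt → ℕₚ.≤-trans lt (ℕₚ.m≤n⊔m (suc (ι g)) k)) bounded

      first : Func (TopologicalSpace.setoid space) (TopologicalSpace.setoid (𝐏 G))
      first = record
        { to   = proj₁ ∘ proj₁
        ; cong = λ {x} {y} (lift e) h → proj₁ (code⇒agree (suc (ι h)) x y (e (suc (ι h)))) h (ℕₚ.n<1+n _)
        }

      -- A basic neighbourhood constrains finitely many values, all fixed by a label beyond their
      -- indices.
      first-continuous : Continuous space (𝐏 G) first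
      first-continuous V V-open x x∈V =
        let (F , h) = V-open _ x∈V ; (k , bounded) = index-bound F
        in k , λ y e → h _ (All.map (λ lt → sym (proj₁ (code⇒agree k x y e) _ lt)) bounded)

      projection-analytic : {S : Pred (Subset G) q} → S ≐ (λ A → ∃ (R A)) → Analytic (𝐏 G) S
      projection-analytic (S⊆ , ⊆S) =
        space , labelled-isPolish labelling , first , first-continuous ,
        (λ {A} A∈S → let (w , r) = S⊆ A∈S in ((A , w) , r) , λ _ → refl) ,
        -- `A` is only pointwise equal to `B`; closedness, with `B` as every approximation,
        -- transfers `R`.
        (λ {A} (((B , w) , r) , B≈A) →
          ⊆S (w , R-closed A w λ k → B , w , r , (λ h _ → sym (B≈A h)) , (λ _ _ → T.refl)))

    -- P-small sets.

    PSmallWitness : Subset G → Pred (ℕ → Carrier) (c ⊔ˡ ℓ)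
    PSmallWitness A g = Injective _≡_ _≈_ g ×
      (∀ m n → m ≢ n → translate G (g m) A ⊥ translate G (g n) A)

    -- A violation involves two terms of `g` and at most two values of `A`, so a close enough
    -- approximation would share it.
    PSmallWitness-closed : Closed setoidᴳ PSmallWitness
    PSmallWitness-closed A g approx =
      (λ {m} {n} eq → let (_ , _ , (inj , _) , _ , g≈) = approx (suc (m ⊔ n)) in
        inj (≈-trans (≈-sym (g≈ m (s≤s (ℕₚ.m≤m⊔n m n)))) (≈-trans eq (g≈ n (s≤s (ℕₚ.m≤n⊔m m n)))))) ,
      (λ m n m≢n ((y , y∈A , x≈) , (z , z∈A , x≈′)) →
        let (_ , _ , (_ , disjoint) , A≡ , g≈) = approx (suc ((m ⊔ n) ⊔ (ι y ⊔ ι z)))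
            m⊔n≤  = ℕₚ.m≤m⊔n (m ⊔ n) (ι y ⊔ ι z)
            ιy⊔ιz≤ = ℕₚ.m≤n⊔m (m ⊔ n) (ι y ⊔ ι z)
        in disjoint m n m≢n
          ((y , trans (sym (A≡ y (s≤s (ℕₚ.≤-trans (ℕₚ.m≤m⊔n (ι y) (ι z)) ιy⊔ιz≤)))) y∈A ,
            ≈-trans x≈ (∙-congʳ (g≈ m (s≤s (ℕₚ.≤-trans (ℕₚ.m≤m⊔n m n) m⊔n≤))))) ,
           (z , trans (sym (A≡ z (s≤s (ℕₚ.≤-trans (ℕₚ.m≤n⊔m (ι y) (ι z)) ιy⊔ιz≤)))) z∈A ,
            ≈-trans x≈′ (∙-congʳ (g≈ n (s≤s (ℕₚ.≤-trans (ℕₚ.m≤n⊔m m n) m⊔n≤)))))))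

    PSmall-analytic : Analytic (𝐏 G) (PSmall G)
    PSmall-analytic = projection-analytic {T = setoidᴳ} countable PSmallWitness-closed
      ((λ r → r) , (λ r → r))

    -- Non-sparse sets.

    -- Writing z n ∈ x k A as x k ⁻¹ ∙ z n ∈ A makes each condition depend on a single value of `A`.
    NonSparseWitness : Subset G → Pred (ℕ → Carrier × Carrier) (c ⊔ˡ ℓ)
    NonSparseWitness A w = Injective _≡_ _≈_ (proj₁ ∘ w) × Injective _≡_ _≈_ (proj₂ ∘ w) ×
      (∀ k n → k < n → Lift (c ⊔ˡ ℓ) (proj₁ (w k) ⁻¹ ∙ proj₂ (w n) ∈ ⟦ G ⟧ A))

    NonSparseWitness-closed : Closed (setoidᴳ ×ₛ setoidᴳ) NonSparseWitness
    NonSparseWitness-closed A w approx =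
      (λ {m} {n} eq → let (_ , _ , (inj , _) , _ , w≈) = approx (suc (m ⊔ n)) in
        inj (≈-trans (≈-sym (proj₁ (w≈ m (s≤s (ℕₚ.m≤m⊔n m n)))))
            (≈-trans eq (proj₁ (w≈ n (s≤s (ℕₚ.m≤n⊔m m n))))))) ,
      (λ {m} {n} eq → let (_ , _ , (_ , inj , _) , _ , w≈) = approx (suc (m ⊔ n)) in
        inj (≈-trans (≈-sym (proj₂ (w≈ m (s≤s (ℕₚ.m≤m⊔n m n)))))
            (≈-trans eq (proj₂ (w≈ n (s≤s (ℕₚ.m≤n⊔m m n))))))) ,
      (λ k n k<n →
        let y = proj₁ (w k) ⁻¹ ∙ proj₂ (w n)
            (B , _ , (_ , _ , ∈B) , A≡ , w≈) = approx (suc (n ⊔ ι y))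
            n≤ = ℕₚ.m≤m⊔n n (ι y)
        -- `y` is formed from the limit `w`; congruence of `B` identifies it with the element formed
        -- from the approximating terms.
        in lift (trans (A≡ y (s≤s (ℕₚ.m≤n⊔m n (ι y))))
             (trans (Func.cong B (∙-cong (⁻¹-cong (proj₁ (w≈ k (s≤s (ℕₚ.≤-trans (ℕₚ.<⇒≤ k<n) n≤)))))
                                         (proj₂ (w≈ n (s≤s n≤)))))
                    (lower (∈B k n k<n)))))

    module _ (x : ℕ → Carrier) where

      Before : ℕ → Pred Carrier ℓ
      Before n g = ∃[ k ] k < n × g ≈ x k

      Before-resp : ∀ n {g h} → g ≈ h → Before n g → Before n h
      Before-resp n g≈h (k , k<n , g≈) = k , k<n , ≈-trans (≈-sym g≈h) g≈

      segment : ℕ → Subset G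
      segment n = comprehension (Before n) (Before-resp n)

      segment⁺ : ∀ n → Before n ⊆ ⟦ G ⟧ (segment n)
      segment⁺ n = ∈-comprehension⁺ (Before n) (Before-resp n)

      segment⁻ : ∀ n → ⟦ G ⟧ (segment n) ⊆ Before n
      segment⁻ n = ∈-comprehension⁻ (Before n) (Before-resp n)

      segment-finite : ∀ n → Finite setoidᴳ (⟦ G ⟧ (segment n))
      segment-finite n = applyUpTo x n , λ g∈ →
        let (k , k<n , g≈) = segment⁻ n g∈ in Any.applyUpTo⁺ x g≈ k<n

      segment⊆ : ∀ X → (∀ k → x k ∈ ⟦ G ⟧ X) → ∀ n → ⟦ G ⟧ (segment n) ⊆ ⟦ G ⟧ X
      segment⊆ X x∈X n g∈ = let (k , _ , g≈) = segment⁻ n g∈ in trans (Func.cong X g≈) (x∈X k)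

      Range : Pred Carrier ℓ
      Range g = ∃[ k ] g ≈ x k

      Range-resp : ∀ {g h} → g ≈ h → Range g → Range h
      Range-resp g≈h (k , g≈) = k , ≈-trans (≈-sym g≈h) g≈

      -- Places a finite set of terms inside an initial segment. A covering list may contain entries
      -- outside the range; these are skipped.
      list-bounded : ∀ xs → ∃[ N ] (∀ {g} → g ∈ˡ xs → Range g → Before N g)
      list-bounded []       = 0 , λ ()
      list-bounded (h ∷ xs) with list-bounded xs | em {P = Range h}
      ... | N , bounded | yes (k , h≈) = suc k ⊔ N , λ
        { (here g≈h)   _ → k , ℕₚ.m≤m⊔n (suc k) N , ≈-trans g≈h h≈
        ; (there g∈xs) r → let (m , m<N , g≈) = bounded g∈xs r
                           in m , ℕₚ.≤-trans m<N (ℕₚ.m≤n⊔m (suc k) N) , g≈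
        }
      ... | N , bounded | no h∉ = N , λ
        { (here g≈h)   r → contradiction (Range-resp g≈h r) h∉
        ; (there g∈xs) r → bounded g∈xs r
        }

    ⋂-translates : Subset G → Subset G → Pred Carrier (c ⊔ˡ ℓ)
    ⋂-translates A F = ⋂ (∃[ g ] g ∈ ⟦ G ⟧ F) (λ (g , _) → translate G g A)

    ¬sparse⇒witness : ∀ {A} → ¬ Sparse G A → ∃ (NonSparseWitness A)
    -- Without a witness `A` would be sparse: an infinite `X` admitting no suitable `F` yields one.
    ¬sparse⇒witness {A} ¬sparse = decidable-stable em λ ∄witness →
      ¬sparse λ X X-infinite → decidable-stable em λ ∄F →
        let (x , x-injective , x∈X) =
              distinct-representatives setoidᴳ (λ _ → ⟦ G ⟧ X) (λ _ → X-infinite)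
            (z , z-injective , z∈) =
              distinct-representatives setoidᴳ (λ n → ⋂-translates A (segment x n))
              -- A finite intersection would make the segment itself a suitable `F`.
              (λ n finite → ∄F
                (segment x n , segment-finite x n , (λ {_} → segment⊆ x X x∈X n) , finite))
        in ∄witness ((λ n → x n , z n) , (λ {_} {_} → x-injective) , (λ {_} {_} → z-injective) ,
          λ k n k<n →
          let (y , y∈A , z≈) = z∈ n (x k , segment⁺ x n (k , k<n , ≈-refl))
          in lift (trans (Func.cong A (≈-trans (∙-congˡ z≈) (\\-leftDividesʳ (x k) y))) y∈A))

    witness⇒¬sparse : ∀ {A} → ∃ (NonSparseWitness A) → ¬ Sparse G A
    witness⇒¬sparse {A} (w , x-injective , z-injective , ∈A) sparse =
      let (F , (xs , F⊆xs) , F⊆X , ⋂-finite) = sparse X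
            (injective⇒infinite setoidᴳ x-injective λ n →
              ∈-comprehension⁺ (Range x) (Range-resp x) (n , ≈-refl))
          (N , bounded) = list-bounded x xs
      -- The shift by `N` puts every index of `z` past all `k < N`, hence every term into the whole
      -- intersection.
      in injective⇒infinite setoidᴳ {s = λ n → z (N + n)} (λ eq → ℕₚ.+-cancelˡ-≡ N _ _ (z-injective eq))
           (λ n (g , g∈F) →
             let (k , k<N , g≈) = bounded (F⊆xs g∈F)
                                 (∈-comprehension⁻ (Range x) (Range-resp x) (F⊆X g∈F)) in
             (x k ⁻¹ ∙ z (N + n)) , lower (∈A k (N + n) (ℕₚ.m≤n⇒m≤n+o n k<N)) ,
             ≈-sym (≈-trans (∙-congʳ g≈) (\\-leftDividesˡ (x k) (z (N + n)))))
           ⋂-finite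
      where
      x = proj₁ ∘ w
      z = proj₂ ∘ w
      X = comprehension (Range x) (Range-resp x)

    -- The sequences x and z are read as one sequence in the countable set of pairs.
    Sparse-coanalytic : Coanalytic (𝐏 G) (Sparse G)
    Sparse-coanalytic = projection-analytic {T = setoidᴳ ×ₛ setoidᴳ} (×-countable countable countable)
      NonSparseWitness-closed ((λ {A} → ¬sparse⇒witness {A}) , (λ {A} → witness⇒¬sparse {A}))

theorem3p3 : (∀ {a} → ExcludedMiddle a) →
    ∀ {c ℓ} (G : Group c ℓ) → Countable (Group.setoid G) →
    Coanalytic (𝐏 G) (Sparse G) × Analytic (𝐏 G) (PSmall G)
theorem3p3 em G countable = Sparse-coanalytic G countable , PSmall-analytic G countable
  where open Classical em
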